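{- Let $\mathcal{G}=(V,E,\lambda)$ be a happy compressed temporal graph that is temporally connected. If $\mathcal{G}$ has more than one pivot edge, then $\mathcal{G}$ is not minimal.
   Context: A happy temporal graph is a triple $\mathcal{G}=(V,E,\lambda)$ where $(V,E)$ is a finite simple undirected graph (the footprint) and $\lambda:E\to\{1,2,3,\dots\}$ assigns a single time label to each edge, such that two distinct edges sharing an endpoint have different labels. It is compressed if for every edge $e$ with $\lambda(e)>1$ there is an edge $e'$ adjacent to $e$ with $\lambda(e')=\lambda(e)-1$. A temporal walk is a walk in the footprint along which edge labels are strictly increasing (so no edge is repeated). For vertices $u,v$ and an edge $e$: $u\leadsto v$ means there is a temporal walk from $u$ to $v$; $v\leadsto e$ means some temporal walk starts at $v$ and traverses $e$; $e\leadsto v$ means some temporal walk traverses $e$ and ends at $v$ (edges may be traversed in either direction). $\mathcal{G}$ is temporally connected if $u\leadsto v$ for all distinct $u,v\in V$. A pivot edge is an edge $e$ such that $v\leadsto e$ and $e\leadsto v$ for all $v\in V$. The reachability graph $\mathcal{R}(\mathcal{G})$ is the directed graph on $V$ with arcs $(u,v)$ whenever $u\leadsto v$; $\mathcal{G}$ is minimal if $\mathcal{R}(\mathcal{G}\setminus\{e\})\ne\mathcal{R}(\mathcal{G})$ for every $e\in E$ (deleting $e$, keeping all vertices and the other labelled edges). -}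

module Defs where

open import Data.Fin.Base using (Fin; punchIn)
open import Data.Fin.Properties using (punchIn-injective)
open import Data.List.Base using (List; []; _∷_)
open import Data.List.Membership.Propositional using (_∈_)
open import Data.List.Relation.Unary.Linked using (Linked)
open import Data.Nat.Base using (ℕ; suc; pred; _∸_; _<_; _>_; _≥_)
open import Data.Product.Base using (Σ-syntax; ∃-syntax; ∃₂; _×_)
open import Data.Sum.Base using (_⊎_)
open import Function.Bundles using (_⇔_)
open import Level using (0ℓ)
open import Relation.Binary.Core using (Rel)
open import Relation.Binary.PropositionalEquality.Core using (_≡_; _≢_)
open import Relation.Nullary.Negation.Core using (¬_)

-- The vertex set is Fin n and the edge set is Fin m.  The order in which
-- end₁ and end₂ list the endpoints of an edge carries no meaning: every notion
-- below goes through the symmetric relations Joins and Incident.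
record HappyTemporalGraph (n m : ℕ) : Set where
  field
    end₁ end₂ : Fin m → Fin n
    label     : Fin m → ℕ

  Joins : Fin m → Fin n → Fin n → Set
  Joins e u v = (end₁ e ≡ u × end₂ e ≡ v) ⊎ (end₁ e ≡ v × end₂ e ≡ u)

  Incident : Fin n → Fin m → Set
  Incident v e = end₁ e ≡ v ⊎ end₂ e ≡ v

  field
    loopless   : ∀ e → end₁ e ≢ end₂ e
    noParallel : ∀ {u v} e f → Joins e u v → Joins f u v → e ≡ f
    positive   : ∀ e → label e ≥ 1
    proper     : ∀ {v} e f → e ≢ f → Incident v e → Incident v f →
                 label e ≢ label f

module _ {n m : ℕ} (G : HappyTemporalGraph n m) where
  open HappyTemporalGraph G

  Adjacent : Fin m → Fin m → Set
  Adjacent e f = e ≢ f × ∃[ v ] (Incident v e × Incident v f)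

  Compressed : Set
  Compressed = ∀ e → label e > 1 →
               ∃[ f ] (Adjacent e f × label f ≡ label e ∸ 1)

  data Walk : Fin n → Fin n → Set where
    nil  : ∀ {u} → Walk u u
    step : ∀ {u v w} (e : Fin m) → Joins e u v → Walk v w → Walk u w

  edges : ∀ {u v} → Walk u v → List (Fin m)
  edges nil          = []
  edges (step e _ p) = e ∷ edges p

  Temporal : ∀ {u v} → Walk u v → Set
  Temporal p = Linked (λ e f → label e < label f) (edges p)

  -- The empty walk counts, so this relation is reflexive.
  Reaches : Rel (Fin n) 0ℓ
  Reaches u v = Σ[ p ∈ Walk u v ] Temporal p

  ReachesEdge : Fin n → Fin m → Set
  ReachesEdge v e = ∃[ w ] Σ[ p ∈ Walk v w ] (Temporal p × e ∈ edges p)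

  EdgeReaches : Fin m → Fin n → Set
  EdgeReaches e v = ∃[ u ] Σ[ p ∈ Walk u v ] (Temporal p × e ∈ edges p)

  TemporallyConnected : Set
  TemporallyConnected = ∀ u v → u ≢ v → Reaches u v

  Pivot : Fin m → Set
  Pivot e = ∀ v → ReachesEdge v e × EdgeReaches e v

  MoreThanOnePivot : Set
  MoreThanOnePivot = ∃₂ λ e f → e ≢ f × Pivot e × Pivot f

-- punchIn e enumerates the edges other than e.
delete : ∀ {n m} → HappyTemporalGraph n m → Fin m → HappyTemporalGraph n (pred m)
delete {m = suc m} G e = record
  { end₁       = λ f → end₁ (punchIn e f)
  ; end₂       = λ f → end₂ (punchIn e f)
  ; label      = λ f → label (punchIn e f)
  ; loopless   = λ f → loopless (punchIn e f)
  ; noParallel = λ f g p q →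
      punchIn-injective e f g (noParallel (punchIn e f) (punchIn e g) p q)
  ; positive   = λ f → positive (punchIn e f)
  ; proper     = λ f g f≢g →
      proper (punchIn e f) (punchIn e g) (λ eq → f≢g (punchIn-injective e f g eq))
  }
  where open HappyTemporalGraph G

-- Equality of reachability graphs: both are digraphs on Fin n, so they are
-- equal exactly when they have the same arcs.
SameReachability : ∀ {n m k} → HappyTemporalGraph n m → HappyTemporalGraph n k → Set
SameReachability G H = ∀ u v → Reaches G u v ⇔ Reaches H u v

Minimal : ∀ {n m} → HappyTemporalGraph n m → Set
Minimal G = ∀ e → ¬ SameReachability (delete G e) G

{-# OPTIONS --safe #-}

-- Let e be a pivot and send every vertex not on e along the edge with which it
-- can depart latest and still arrive at e; these parent edges have labels
-- smaller than label e and are distinct.  A walk from e onwards only uses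
-- labels from label e on, so an edge g ≠ e with label g ≤ label e that is not
-- a parent edge can be deleted without losing temporal connectivity.
--
-- Now let e ≠ f be pivots with label e ≤ label f in a minimal graph on n
-- vertices.  The edge e together with the n − 2 parent edges towards e are
-- n − 1 edges other than f with labels at most label f, so all of them are
-- among the n − 2 parent edges towards f, which is impossible.
module Submission where

open import Defs
open import Data.Empty using (⊥)
open import Data.Fin.Base using (Fin; punchIn; punchOut)
open import Data.Fin.Properties
  using (_≟_; any?; punchIn-punchOut; punchOut-injective; injective⇒≤)
open import Data.List.Base using (_∷_)
open import Data.List.Membership.Propositional using (_∈_)
open import Data.List.Relation.Unary.All using (All; []; _∷_)
import Data.List.Relation.Unary.All as All
open import Data.List.Relation.Unary.Any using (here; there)
open import Data.List.Relation.Unary.Linked using (Linked; []; [-]; _∷_)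
import Data.List.Relation.Unary.Linked as Linked
open import Data.Nat.Base
  using (ℕ; zero; suc; _+_; _≤_; _<_; _≤′_; z≤n; s≤s; ≤′-refl; ≤′-step)
import Data.Nat.Properties as ℕ
open import Data.Product.Base using (Σ-syntax; ∃-syntax; _×_; _,_; proj₁; proj₂)
open import Data.Sum.Base using (_⊎_; inj₁; inj₂)
open import Function.Bundles using (mk⇔)
open import Level using (0ℓ)
open import Relation.Binary.Core using (Rel)
open import Relation.Binary.PropositionalEquality
  using (_≡_; _≢_; refl; sym; trans; cong; subst; ≢-sym)
open import Relation.Nullary using (Dec; yes; no)
open import Relation.Nullary.Decidable using (_×-dec_; _⊎-dec_)
open import Relation.Nullary.Negation.Core using (¬_; contradiction)

-- Pigeonhole principle.

missesPoint⇒¬injective : ∀ {n} (f : Fin n → Fin n) (y : Fin n) →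
  (∀ x → y ≢ f x) → ¬ (∀ {x x′} → f x ≡ f x′ → x ≡ x′)
missesPoint⇒¬injective {suc n} f y misses injective =
  -- Omitting `y` from the codomain would leave an injection of `suc n` points into `n` points.
  ℕ.<-irrefl refl (injective⇒≤ {f = λ x → punchOut (misses x)}
    λ {x} {x′} eq → injective (punchOut-injective (misses x) (misses x′) eq))

-- Incidence, and latest departures towards an edge.

module _ {n m : ℕ} (G : HappyTemporalGraph n m) where
  open HappyTemporalGraph G

  incident? : ∀ v e → Dec (Incident v e)
  incident? v e = (end₁ e ≟ v) ⊎-dec (end₂ e ≟ v)

  joins? : ∀ e u v → Dec (Joins e u v)
  joins? e u v = ((end₁ e ≟ u) ×-dec (end₂ e ≟ v)) ⊎-dec ((end₁ e ≟ v) ×-dec (end₂ e ≟ u))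

  joins⇒incidentˡ : ∀ {e u v} → Joins e u v → Incident u e
  joins⇒incidentˡ (inj₁ (p , _)) = inj₁ p
  joins⇒incidentˡ (inj₂ (_ , q)) = inj₂ q

  joins⇒incidentʳ : ∀ {e u v} → Joins e u v → Incident v e
  joins⇒incidentʳ (inj₁ (_ , q)) = inj₂ q
  joins⇒incidentʳ (inj₂ (p , _)) = inj₁ p

  incident-joins : ∀ {e u v x} → Joins e u v → Incident x e → x ≡ u ⊎ x ≡ v
  incident-joins (inj₁ (refl , refl)) (inj₁ refl) = inj₁ refl
  incident-joins (inj₁ (refl , refl)) (inj₂ refl) = inj₂ refl
  incident-joins (inj₂ (refl , refl)) (inj₁ refl) = inj₂ refl
  incident-joins (inj₂ (refl , refl)) (inj₂ refl) = inj₁ refl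

  incident⇒≡⊎joins : ∀ {e x y} → Incident x e → Incident y e → x ≡ y ⊎ Joins e x y
  incident⇒≡⊎joins (inj₁ refl) (inj₁ refl) = inj₁ refl
  incident⇒≡⊎joins (inj₁ refl) (inj₂ refl) = inj₂ (inj₁ (refl , refl))
  incident⇒≡⊎joins (inj₂ refl) (inj₁ refl) = inj₂ (inj₂ (refl , refl))
  incident⇒≡⊎joins (inj₂ refl) (inj₂ refl) = inj₁ refl

  -- From v one can arrive at e departing no earlier than k time units before e.
  Arrives : Fin m → ℕ → Fin n → Set
  Arrives e zero    v = Incident v e
  Arrives e (suc k) v = Arrives e k v ⊎
    ∃[ g ] ∃[ w ] (Joins g v w × label g + suc k ≡ label e × Arrives e k w)

  arrives? : ∀ e k v → Dec (Arrives e k v)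
  arrives? e zero    v = incident? v e
  arrives? e (suc k) v = arrives? e k v ⊎-dec
    any? λ g → any? λ w →
      joins? g v w ×-dec (label g + suc k ℕ.≟ label e) ×-dec arrives? e k w

  arrives-mono′ : ∀ {e k l v} → k ≤′ l → Arrives e k v → Arrives e l v
  arrives-mono′ ≤′-refl       a = a
  arrives-mono′ (≤′-step k≤l) a = inj₁ (arrives-mono′ k≤l a)

  arrives-mono : ∀ {e k l v} → k ≤ l → Arrives e k v → Arrives e l v
  arrives-mono k≤l = arrives-mono′ (ℕ.≤⇒≤′ k≤l)

  walk⇒arrives : ∀ {e g u v w} (j : Joins g u v) (p : Walk G v w) →
    Temporal G (step g j p) → e ∈ edges G (step g j p) →
    ∃[ k ] (label g + k ≡ label e × Arrives e k u)
  walk⇒arrives j p t (here refl) = 0 , ℕ.+-identityʳ _ , joins⇒incidentˡ j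
  walk⇒arrives {e} {g} j (step h j′ p) (g<h ∷ t) (there e∈)
    with k , h+k≡e , a ← walk⇒arrives j′ p t e∈
    -- The slack `o` in `g<h` is extra waiting time before `h`, by which the bound `k` is padded.
    with o , g+o≡h ← ℕ.m≤n⇒∃[o]m+o≡n g<h =
      suc (o + k) , eq , inj₂ (g , _ , j , eq , arrives-mono (ℕ.m≤n+m k o) a)
    where
    eq : label g + suc (o + k) ≡ label e
    eq = trans (ℕ.+-suc (label g) (o + k))
        (trans (cong suc (sym (ℕ.+-assoc (label g) o k)))
        (trans (cong (_+ k) g+o≡h) h+k≡e))

  -- The last argument of `via` says that `v` cannot arrive at `e` when departing later than
  -- `label g`, so `g` is a latest departure.
  data Exit (e : Fin m) (v : Fin n) : Set where
    root : Incident v e → Exit e v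
    via  : ∀ g w k → Joins g v w → label g + suc k ≡ label e →
           Arrives e k w → ¬ Arrives e k v → Exit e v

  -- Decidability lets `k` be lowered until one unit less no longer suffices or `v` is found to lie
  -- on `e`.
  latestExit : ∀ e k v → Arrives e k v → Exit e v
  latestExit e zero    v i        = root i
  latestExit e (suc k) v (inj₁ a) = latestExit e k v a
  latestExit e (suc k) v (inj₂ (g , w , j , eq , b)) with arrives? e k v
  ... | yes a = latestExit e k v a
  ... | no ¬a = via g w k j eq b ¬a

  exitEdge : ∀ {e v} → Exit e v → Fin m
  exitEdge {e} (root _)            = e
  exitEdge     (via g _ _ _ _ _ _) = g

  -- The forest of parent edges rooted at an edge.

  record InForest (e : Fin m) : Set where
    field
      parentEdge  : Fin n → Fin m
      parent-root : ∀ {v} → Incident v e → parentEdge v ≡ e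
      parent-hop  : ∀ {v} → ¬ Incident v e →
        ∃[ w ] (Joins (parentEdge v) v w × label (parentEdge v) < label (parentEdge w))
      parent-≤    : ∀ v → label (parentEdge v) ≤ label e

    parent-incident : ∀ v → Incident v (parentEdge v)
    parent-incident v with incident? v e
    ... | yes i = subst (Incident v) (sym (parent-root i)) i
    ... | no ¬i = joins⇒incidentˡ (proj₁ (proj₂ (parent-hop ¬i)))

    parent-< : ∀ {v} → ¬ Incident v e → label (parentEdge v) < label e
    parent-< ¬i with w , _ , lt ← parent-hop ¬i = ℕ.<-≤-trans lt (parent-≤ w)

    -- A vertex on the parent edge of `v` is `v` or the next vertex `w`, and the parent edge of `w`
    -- has a larger label.
    parent-injective-offRoot : ∀ {v v′} → ¬ Incident v e →
      parentEdge v ≡ parentEdge v′ → v ≡ v′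
    parent-injective-offRoot {v} {v′} ¬i eq
      with w , j , lt ← parent-hop ¬i
      with incident-joins j (subst (Incident v′) (sym eq) (parent-incident v′))
    ... | inj₁ v′≡v = sym v′≡v
    ... | inj₂ refl = contradiction lt (ℕ.<-irrefl (cong label eq))

    -- Only the two ends of `e` share a parent edge, namely `e`; leaving out one end restores
    -- injectivity.
    parent-injective : ∀ {v v′} → end₂ e ≢ v → end₂ e ≢ v′ →
      parentEdge v ≡ parentEdge v′ → v ≡ v′
    parent-injective {v} {v′} ≢v ≢v′ eq with incident? v e | incident? v′ e
    ... | no ¬i          | _               = parent-injective-offRoot ¬i eq
    ... | yes _          | no ¬i′          = sym (parent-injective-offRoot ¬i′ (sym eq))
    ... | yes (inj₁ a≡v) | yes (inj₁ a≡v′) = trans (sym a≡v) a≡v′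
    ... | yes (inj₂ b≡v) | yes _           = contradiction b≡v ≢v
    ... | yes (inj₁ _)   | yes (inj₂ b≡v′) = contradiction b≡v′ ≢v′

  inForest : ∀ e → (∀ v → ReachesEdge G v e) → InForest e
  inForest e reaches = record
    { parentEdge  = λ v → exitEdge (exit v)
    ; parent-root = λ {v} → exit-root (exit v)
    ; parent-hop  = λ {v} → exit-hop (exit v)
    ; parent-≤    = λ v → exit-≤ (exit v)
    }
    where
    exit : ∀ v → Exit e v
    exit v with _ , step g j p , t , e∈ ← reaches v
           with k , _ , a ← walk⇒arrives j p t e∈ = latestExit e k v a

    exit-≤ : ∀ {v} (x : Exit e v) → label (exitEdge x) ≤ label e
    exit-≤ (root _)             = ℕ.≤-refl
    exit-≤ (via g _ k _ eq _ _) = subst (label g ≤_) eq (ℕ.m≤m+n (label g) (suc k))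

    exit-root : ∀ {v} (x : Exit e v) → Incident v e → exitEdge x ≡ e
    exit-root (root _)             _ = refl
    exit-root (via _ _ k _ _ _ ¬a) i = contradiction (arrives-mono z≤n i) ¬a

    -- For an exit by `via`, `w` arrives within `k` but not within `k′`, so monotonicity gives
    -- `k′ < k`; as both sums equal `label e`, the labels compare the other way.
    exit-< : ∀ {g k w} → label g + suc k ≡ label e → Arrives e k w →
      (x : Exit e w) → label g < label (exitEdge x)
    exit-< {g} {k} eq a (root _) =
      subst (label g <_) eq (ℕ.m<m+n (label g) (s≤s z≤n))
    exit-< {g} {k} eq a (via g′ _ k′ _ eq′ _ ¬a) =
      ℕ.+-cancelʳ-< (suc k) (label g) (label g′)
        (subst (_< label g′ + suc k) (trans eq′ (sym eq))
          (ℕ.+-monoʳ-< (label g′) (s≤s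
            (ℕ.≰⇒> λ k≤k′ → ¬a (arrives-mono k≤k′ a)))))

    exit-hop : ∀ {v} (x : Exit e v) → ¬ Incident v e →
      ∃[ w ] (Joins (exitEdge x) v w × label (exitEdge x) < label (exitEdge (exit w)))
    exit-hop (root i)             ¬i = contradiction i ¬i
    exit-hop (via g w k j eq a _) _  = w , j , exit-< {g} eq a (exit w)

  -- Walks that avoid an edge.

  data From (g : Fin m) (τ : ℕ) : Rel (Fin n) 0ℓ where
    nil  : ∀ {u} → From g τ u u
    -- The index `suc (label e)` carries strict increase, so walks are prefixed without a look at
    -- their first edge.
    step : ∀ {u v w} e → e ≢ g → τ ≤ label e → Joins e u v →
           From g (suc (label e)) v w → From g τ u w

  from-weaken : ∀ {g τ σ u v} → τ ≤ σ → From g σ u v → From g τ u v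
  from-weaken τ≤σ nil                = nil
  from-weaken τ≤σ (step e e≢g σ≤ j p) = step e e≢g (ℕ.≤-trans τ≤σ σ≤) j p

  -- Labels after `e` exceed `label e`, hence `label g`, so `g` cannot occur.
  tail⇒from : ∀ {e g u v w} (j : Joins e u v) (p : Walk G v w) →
    Temporal G (step e j p) → label g ≤ label e → From g (suc (label e)) v w
  tail⇒from j nil            t         g≤e = nil
  tail⇒from j (step h j′ p) (e<h ∷ t) g≤e =
    step h (λ { refl → ℕ.<⇒≱ e<h g≤e }) e<h j′
      (tail⇒from j′ p t (ℕ.≤-trans g≤e (ℕ.<⇒≤ e<h)))

  walk⇒from : ∀ {e g u v} (p : Walk G u v) → Temporal G p → e ∈ edges G p →
    label g ≤ label e → ∃[ x ] (Incident x e × From g (suc (label e)) x v)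
  walk⇒from (step e j p) t (here refl) g≤e =
    _ , joins⇒incidentʳ j , tail⇒from j p t g≤e
  walk⇒from (step h j p) t (there e∈)  g≤e = walk⇒from p (Linked.tail t) e∈ g≤e

  -- A walk through `e` leaves it at one of its ends. From that end `e` is skipped; from the other
  -- end it is crossed first.
  pivot⇒from : ∀ {e g x v} → EdgeReaches G e v → g ≢ e → label g ≤ label e →
    Incident x e → From g (label e) x v
  pivot⇒from {e} (_ , p , t , e∈) g≢e g≤e i
    with y , i′ , q ← walk⇒from p t e∈ g≤e
    with incident⇒≡⊎joins i i′
  ... | inj₁ refl = from-weaken (ℕ.n≤1+n _) q
  ... | inj₂ j    = step e (≢-sym g≢e) ℕ.≤-refl j q

  module _ {e} (F : InForest e) where
    open InForest F

    -- The fuel k bounds the time left until e.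
    forest⇒from : ∀ {g v} → (∀ u → parentEdge u ≢ g) →
      (∀ {x} → Incident x e → From g (label e) x v) →
      ∀ k u → label e ≤ label (parentEdge u) + k → From g (label (parentEdge u)) u v
    forest⇒from avoids onwards k u e≤ with incident? u e
    ... | yes i = from-weaken (parent-≤ u) (onwards i)
    ... | no ¬i with w , j , lt ← parent-hop ¬i with k
    ...   | zero  = contradiction (parent-< ¬i)
                      (ℕ.≤⇒≯ (subst (label e ≤_) (ℕ.+-identityʳ _) e≤))
    ...   | suc l = step (parentEdge u) (avoids u) ℕ.≤-refl j
              (from-weaken lt (forest⇒from avoids onwards l w
                (ℕ.≤-trans (subst (label e ≤_) (ℕ.+-suc _ l) e≤) (ℕ.+-monoˡ-≤ l lt))))

-- Transfer of walks to the graph without the edge.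

module _ {n m : ℕ} (G : HappyTemporalGraph n (suc m)) (g : Fin (suc m)) where
  private
    module G = HappyTemporalGraph G
    module D = HappyTemporalGraph (delete G g)

  linked-∷ : ∀ {e es} → All (λ f → D.label e < D.label f) es →
    Linked (λ e f → D.label e < D.label f) es →
    Linked (λ e f → D.label e < D.label f) (e ∷ es)
  linked-∷ []      [] = [-]
  linked-∷ (p ∷ _) t  = p ∷ t

  -- The `All` component strengthens the induction: it bounds whatever edge follows a newly prefixed
  -- one.
  from⇒walk : ∀ {τ u v} → From G g τ u v →
    Σ[ p ∈ Walk (delete G g) u v ]
      (Temporal (delete G g) p × All (λ e → τ ≤ D.label e) (edges (delete G g) p))
  from⇒walk nil = nil , [] , []
  from⇒walk {τ} {u} (step {v = v} e e≢g τ≤e j q) with p , t , late ← from⇒walk q =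
    step e′ (subst (λ h → G.Joins h u v) (sym e′≡e) j) p ,
    linked-∷ late′ t ,
    τ≤e′ ∷ All.map (λ lt → ℕ.≤-trans τ≤e′ (ℕ.<⇒≤ lt)) late′
    where
    e′ : Fin m
    e′ = punchOut (≢-sym e≢g)
    e′≡e : punchIn g e′ ≡ e
    e′≡e = punchIn-punchOut (≢-sym e≢g)
    τ≤e′ : τ ≤ D.label e′
    τ≤e′ = subst (λ h → τ ≤ G.label h) (sym e′≡e) τ≤e
    late′ : All (λ f → D.label e′ < D.label f) _
    late′ = subst (λ h → All (λ f → G.label h < D.label f) _) (sym e′≡e) late

-- Pivots in a minimal graph.

module _ {n m : ℕ} (G : HappyTemporalGraph n m) (connected : TemporallyConnected G) where
  open HappyTemporalGraph G
  open InForest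

  -- Parent edges lead from `u` to `e` and a walk from `e` onwards leads to `v`, both avoiding `g`;
  -- so reachability is total on either side.
  nonParent-superfluous : ∀ {e g} → Pivot G e → (F : InForest G e) → g ≢ e →
    label g ≤ label e → (∀ u → parentEdge F u ≢ g) → SameReachability (delete G g) G
  nonParent-superfluous {e} {g} pivot F g≢e g≤e avoids u v =
    mk⇔ (λ _ → reaches) λ _ → reaches′ G pivot F g≢e g≤e avoids
    where
    reaches : Reaches G u v
    reaches with u ≟ v
    ... | yes refl = nil , []
    ... | no u≢v   = connected u v u≢v

    -- G is generalised because delete computes only when m is a successor.
    reaches′ : ∀ {m} (G : HappyTemporalGraph n m) {e g : Fin m} → Pivot G e →
      (F : InForest G e) → g ≢ e →
      HappyTemporalGraph.label G g ≤ HappyTemporalGraph.label G e →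
      (∀ u → parentEdge F u ≢ g) → Reaches (delete G g) u v
    reaches′ {suc _} G pivot F g≢e g≤e avoids
      with p , t , _ ← from⇒walk G _ (forest⇒from G F avoids
             (pivot⇒from G (proj₂ (pivot v)) g≢e g≤e) _ u (ℕ.m≤n+m _ _)) = p , t

  module _ (minimal : Minimal G) where

    minimal⇒parent : ∀ {f g} → Pivot G f → (F : InForest G f) → g ≢ f →
      label g ≤ label f → ∃[ u ] (parentEdge F u ≡ g)
    minimal⇒parent {f} {g} pivot F g≢f g≤f with any? (λ u → parentEdge F u ≟ g)
    ... | yes found = found
    ... | no ¬found = contradiction
          (nonParent-superfluous pivot F g≢f g≤f λ u eq → ¬found (u , eq)) (minimal g)

    -- The count becomes an injective self-map of the vertices missing `end₂ f`: apart from
    -- `end₂ e`, a vertex goes to one whose parent edge towards `f` is its own parent edge towards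
    -- `e`.
    ordered-pivots-absurd : ∀ {e f} → e ≢ f → label e ≤ label f →
      Pivot G e → Pivot G f → ⊥
    ordered-pivots-absurd {e} {f} e≢f e≤f pe pf =
      missesPoint⇒¬injective (λ v → proj₁ (image v)) (end₂ f)
        (λ v → misses (proj₂ (image v)))
        (λ {v} {v′} eq → injective (proj₂ (image v)) (proj₂ (image v′)) eq)
      where
      E : InForest G e
      E = inForest G e (λ v → proj₁ (pe v))
      F : InForest G f
      F = inForest G f (λ v → proj₁ (pf v))

      parent≢f : ∀ v → parentEdge E v ≢ f
      parent≢f v eq with incident? G v e
      ... | yes i = e≢f (trans (sym (parent-root E i)) eq)
      -- Off `e`, parent edges have labels below `label e`, hence below `label f`.
      ... | no ¬i = ℕ.<⇒≱ (parent-< E ¬i) (subst (λ h → label e ≤ label h) (sym eq) e≤f)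

      -- The value at the spare vertex end₂ e is the vertex end₁ f, which is
      -- not needed for a parent edge; end₂ f is never hit.
      Image : Fin n → Fin n → Set
      Image v u = (end₂ e ≡ v × end₁ f ≡ u) ⊎
                  (end₂ e ≢ v × ¬ Incident u f × parentEdge F u ≡ parentEdge E v)

      image : ∀ v → ∃[ u ] Image v u
      image v with end₂ e ≟ v
      ... | yes eq = end₁ f , inj₁ (eq , refl)
      ... | no ≢v with u , eq ← minimal⇒parent pf F (parent≢f v)
                                  (ℕ.≤-trans (parent-≤ E v) e≤f) =
        -- If `u` were on `f`, its parent edge would be `f`, which is no parent edge towards `e`.
        u , inj₂ (≢v , (λ i → parent≢f v (trans (sym eq) (parent-root F i))) , eq)

      misses : ∀ {v u} → Image v u → end₂ f ≢ u
      misses (inj₁ (_ , eq))     eq′ = loopless f (trans eq (sym eq′))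
      misses (inj₂ (_ , ¬i , _)) eq  = ¬i (inj₂ eq)

      injective : ∀ {v v′ u u′} → Image v u → Image v′ u′ → u ≡ u′ → v ≡ v′
      injective (inj₁ (p , _))      (inj₁ (q , _))       _    = trans (sym p) q
      -- A mixed pair cannot collide: `end₁ f` is on `f`, the other value is not.
      injective (inj₁ (_ , p))      (inj₂ (_ , ¬i , _))  refl = contradiction (inj₁ p) ¬i
      injective (inj₂ (_ , ¬i , _)) (inj₁ (_ , p))       refl = contradiction (inj₁ p) ¬i
      injective (inj₂ (≢v , _ , p)) (inj₂ (≢v′ , _ , q)) refl =
        parent-injective E ≢v ≢v′ (trans (sym p) q)

lemma3p32 : ∀ {n m : ℕ} (G : HappyTemporalGraph n m) →
    Compressed G → TemporallyConnected G → MoreThanOnePivot G → ¬ Minimal G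
lemma3p32 G _ connected (e , f , e≢f , pe , pf) minimal with ℕ.≤-total (label e) (label f)
  where open HappyTemporalGraph G
... | inj₁ e≤f = ordered-pivots-absurd G connected minimal e≢f e≤f pe pf
... | inj₂ f≤e = ordered-pivots-absurd G connected minimal (≢-sym e≢f) f≤e pf pe
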